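{- Let $k\ge 2$. In the online version of balanced interval $k$-coloring, the imbalance is unbounded: for every (deterministic) online algorithm and every $M\in\mathbb{N}$, there is a finite input sequence of intervals on which the coloring produced by the algorithm has imbalance greater than $M$.
   Context: Online model: closed intervals arrive one at a time in order of their startpoints; upon arrival the full interval (including its endpoint) is revealed and the algorithm must irrevocably assign it a color from $\{1,\dots,k\}$. For a coloring $\chi$ of a finite set of intervals, let $c_i(x)$ be the number of intervals containing $x$ with color $i$; the imbalance of $\chi$ is $\max_{x\in\mathbb{R}}\max_{i,j}|c_i(x)-c_j(x)|$. -}

module Defs where

open import Data.Fin.Base using (Fin; toℕ)
open import Data.Fin.Subset using (_∈_; ∣_∣)
open import Data.List.Base using (List; length; lookup; take)
import Data.List.Relation.Binary.Equality.Setoid as ListEquality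
open import Data.List.Relation.Unary.AllPairs using (AllPairs)
open import Data.Nat.Base as ℕ using (ℕ; ∣_-_∣)
open import Data.Product.Base using (_×_; _,_; ∃; ∃-syntax)
open import Data.Product.Relation.Binary.Pointwise.NonDependent using (_×ₛ_)
open import Data.Rational.Base as ℚ using (ℚ)
open import Data.Sum.Base using (_⊎_)
open import Function.Bundles using (Func; _⇔_)
open import Level using (0ℓ; suc)
open import Relation.Binary.Bundles using (Setoid)
open import Relation.Binary.PropositionalEquality using (_≡_; setoid)
open import Relation.Nullary.Negation using (¬_)

-- Two-sided Dedekind cuts in ℚ.
record ℝ : Set₁ where
  field
    L U         : ℚ → Set
    L-inhabited : ∃ L
    U-inhabited : ∃ U
    L-rounded   : ∀ q → L q ⇔ (∃[ r ] q ℚ.< r × L r)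
    U-rounded   : ∀ q → U q ⇔ (∃[ r ] r ℚ.< q × U r)
    disjoint    : ∀ q → ¬ (L q × U q)
    located     : ∀ q r → q ℚ.< r → L q ⊎ U r

infix 4 _≤_ _≃_

_≤_ : ℝ → ℝ → Set
x ≤ y = ∀ q → ℝ.L x q → ℝ.L y q

_≃_ : ℝ → ℝ → Set
x ≃ y = x ≤ y × y ≤ x

record Interval : Set₁ where
  field
    start end : ℝ
    start≤end : start ≤ end

open Interval public using (start; end)

_∈ᴵ_ : ℝ → Interval → Set
x ∈ᴵ I = start I ≤ x × x ≤ end I

intervalSetoid : Setoid (suc 0ℓ) 0ℓ
intervalSetoid = record
  { Carrier       = Interval
  ; _≈_           = λ I J → start I ≃ start J × end I ≃ end J
  ; isEquivalence = record
    { refl  = ((λ _ p → p) , (λ _ p → p)) , ((λ _ p → p) , (λ _ p → p))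
    ; sym   = λ ((a , b) , (c , d)) → (b , a) , (d , c)
    ; trans = λ ((a , b) , (c , d)) ((a′ , b′) , (c′ , d′)) →
        ((λ q p → a′ q (a q p)) , (λ q p → b q (b′ q p))) ,
        ((λ q p → c′ q (c q p)) , (λ q p → d q (d′ q p)))
    }
  }

-- Intervals are listed in order of arrival; equal startpoints and repeated
-- intervals are allowed.
ArrivalOrder : List Interval → Set₁
ArrivalOrder = AllPairs (λ I J → start I ≤ start J)

-- The members of the family are identified by their positions in the list.
Coloring : ℕ → List Interval → Set
Coloring k σ = Fin (length σ) → Fin k

-- A color for the new interval, given the list of earlier intervals. The
-- earlier colors need not be an argument: a deterministic algorithm can
-- recompute them. Being a setoid map, the algorithm depends on the endpoints
-- as real numbers, not on the cuts chosen to represent them.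
OnlineAlgorithm : ℕ → Set₁
OnlineAlgorithm k =
  Func (ListEquality.≋-setoid intervalSetoid ×ₛ intervalSetoid) (setoid (Fin k))

run : ∀ {k} → OnlineAlgorithm k → (σ : List Interval) → Coloring k σ
run A σ p = Func.to A (take (toℕ p) σ , lookup σ p)

-- ColorCount σ χ i x c says that cᵢ(x) = c. It is a relation because x ∈ᴵ I
-- is not decidable for real numbers.
ColorCount : ∀ {k} (σ : List Interval) → Coloring k σ → Fin k → ℝ → ℕ → Set
ColorCount σ χ i x c =
  ∃[ S ] (∀ p → p ∈ S ⇔ (x ∈ᴵ lookup σ p × χ p ≡ i)) × ∣ S ∣ ≡ c

-- d = ∣ cᵢ(x) - cⱼ(x) ∣ for some point x and some colors i, j.
Discrepancy : ∀ {k} (σ : List Interval) → Coloring k σ → ℕ → Set₁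
Discrepancy {k} σ χ d =
  ∃[ x ] ∃[ i ] ∃[ j ] ∃[ a ] ∃[ b ]
    ColorCount σ χ i x a × ColorCount σ χ j x b × d ≡ ∣ a - b ∣

IsImbalance : ∀ {k} (σ : List Interval) → Coloring k σ → ℕ → Set₁
IsImbalance σ χ m = Discrepancy σ χ m × (∀ d → Discrepancy σ χ d → d ℕ.≤ m)

{-# OPTIONS --safe #-}

-- All intervals start at 0, so a point x ≥ 0 sees exactly the intervals whose
-- end is at least x. By bisection the adversary keeps the ends of the intervals
-- of color 0 to the right of all other ends. If more than M intervals have
-- color 0, then the leftmost of their ends sees these and no others. Otherwise,
-- after 2Mk + 1 rounds, some color has been used more than 2M times and color 0
-- at most M times, and the point 0 sees all intervals.

module Submission where

open import Defs
open import Data.Nat.Base using (ℕ) renaming (_≤_ to _≤ℕ_; _<_ to _<ℕ_)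
open import Data.Product.Base using (_×_; ∃-syntax)

open import Data.Fin.Base using (Fin; zero; suc; toℕ)
open import Data.Fin.Properties using (_≟_; any?)
open import Data.Fin.Subset
  using (Subset; inside; outside; _∈_; _⊆_; _∪_; ⋃; ⊤; ∣_∣; Nonempty; Empty)
open import Data.Fin.Subset.Properties
  using (_∈?_; nonempty?; Empty-unique; ∣⊥∣≡0; ∣⊤∣≡n; ⊆-antisym; p⊆q⇒∣p∣≤∣q∣; p⊆p∪q; q⊆p∪q; x∈p∪q⁻)
open import Data.List.Base
  using (List; []; _∷_; _++_; _∷ʳ_; allFin; cartesianProduct; filter; length; lookup; map; tabulate; take)
import Data.List.Extrema as Extrema
open import Data.List.Extrema.Nat using (max; argmax-all; xs≤max)
open import Data.List.Membership.Propositional.Properties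
  using (∈-allFin; ∈-cartesianProduct⁺; ∈-filter⁺; ∈-map⁺)
open import Data.List.Properties using (++-assoc; ++-identityʳ; tabulate-lookup)
import Data.List.Relation.Unary.All as All
import Data.List.Relation.Unary.All.Properties as All
import Data.List.Relation.Unary.AllPairs.Properties as AllPairs
open import Data.Nat.Base as ℕ using (suc; ∣_-_∣)
import Data.Nat.Properties as ℕ
open import Data.Product.Base using (_,_; proj₁; proj₂)
open import Data.Rational.Base as ℚ using (ℚ; 0ℚ; 1ℚ)
import Data.Rational.Properties as ℚ
open import Data.Sum.Base using (_⊎_; inj₁; inj₂; [_,_]′)
import Data.Vec.Base as Vec
open import Data.Vec.Properties using ([]=⇒lookup; lookup⇒[]=; lookup∘tabulate)
open import Function.Base using (id; _∘_)
open import Function.Bundles using (Func; _⇔_; mk⇔; Equivalence)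
open import Level using (Level)
open import Relation.Binary.Bundles using (DecTotalOrder)
open import Relation.Binary.PropositionalEquality
  using (_≡_; refl; sym; trans; cong; cong₂; subst; subst₂)
open import Relation.Nullary using (¬_; Dec; yes; no; does; contradiction)
open import Relation.Nullary.Decidable using (_×-dec_; dec-true)

private variable
  ℓ : Level
  k n : ℕ

-- Decidable subsets of a finite set and a pigeonhole principle.

module _ {P : Fin n → Set ℓ} (P? : ∀ p → Dec (P p)) where

  select : Subset n
  select = Vec.tabulate (does ∘ P?)

  ∈-select⁺ : ∀ {p} → P p → p ∈ select
  ∈-select⁺ {p} Pp =
    lookup⇒[]= p _ (trans (lookup∘tabulate _ p) (dec-true (P? p) Pp))

  ∈-select⁻ : ∀ {p} → p ∈ select → P p
  ∈-select⁻ {p} p∈ with P? p | trans (sym (lookup∘tabulate (does ∘ P?) p)) ([]=⇒lookup p∈)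
  ... | yes Pp | _ = Pp

Empty⇒∣p∣≡0 : {S : Subset n} → Empty S → ∣ S ∣ ≡ 0
Empty⇒∣p∣≡0 {n} empty = trans (cong ∣_∣ (Empty-unique empty)) (∣⊥∣≡0 n)

∣p∪q∣≤∣p∣+∣q∣ : (p q : Subset n) → ∣ p ∪ q ∣ ≤ℕ ∣ p ∣ ℕ.+ ∣ q ∣
∣p∪q∣≤∣p∣+∣q∣ Vec.[]              Vec.[]              = ℕ.z≤n
∣p∪q∣≤∣p∣+∣q∣ (outside Vec.∷ p) (outside Vec.∷ q) = ∣p∪q∣≤∣p∣+∣q∣ p q
∣p∪q∣≤∣p∣+∣q∣ (outside Vec.∷ p) (inside Vec.∷ q)  =
  ℕ.≤-trans (ℕ.s≤s (∣p∪q∣≤∣p∣+∣q∣ p q)) (ℕ.≤-reflexive (sym (ℕ.+-suc ∣ p ∣ ∣ q ∣)))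
∣p∪q∣≤∣p∣+∣q∣ (inside Vec.∷ p)  (outside Vec.∷ q) = ℕ.s≤s (∣p∪q∣≤∣p∣+∣q∣ p q)
∣p∪q∣≤∣p∣+∣q∣ (inside Vec.∷ p)  (inside Vec.∷ q)  =
  ℕ.s≤s (ℕ.≤-trans (∣p∪q∣≤∣p∣+∣q∣ p q) (ℕ.+-monoʳ-≤ ∣ p ∣ (ℕ.n≤1+n ∣ q ∣)))

⊆-⋃ : (S : Fin k → Subset n) (i : Fin k) → S i ⊆ ⋃ (tabulate S)
⊆-⋃ S zero    p∈ = p⊆p∪q _ p∈
⊆-⋃ S (suc i) p∈ = q⊆p∪q (S zero) _ (⊆-⋃ (S ∘ suc) i p∈)

∣⋃∣≤k*B : ∀ {B} (S : Fin k → Subset n) → (∀ i → ∣ S i ∣ ≤ℕ B) →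
  ∣ ⋃ (tabulate S) ∣ ≤ℕ k ℕ.* B
∣⋃∣≤k*B {ℕ.zero} {n} S ∣S∣≤B = ℕ.≤-reflexive (∣⊥∣≡0 n)
∣⋃∣≤k*B {suc k}      S ∣S∣≤B = ℕ.≤-trans (∣p∪q∣≤∣p∣+∣q∣ (S zero) _)
  (ℕ.+-mono-≤ (∣S∣≤B zero) (∣⋃∣≤k*B (S ∘ suc) (∣S∣≤B ∘ suc)))

-- If all `k` sets had at most `B` elements, their union, which is everything, would have at most
-- `k * B`. The union bound makes disjointness unnecessary to establish.
cover-pigeonhole : ∀ {B} (S : Fin k → Subset n) → (∀ p → ∃[ i ] p ∈ S i) →
  k ℕ.* B <ℕ n → ∃[ i ] B <ℕ ∣ S i ∣
cover-pigeonhole {k} {n} {B} S cover kB<n with any? (λ i → B ℕ.<? ∣ S i ∣)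
... | yes big  = big
... | no ¬big = contradiction kB<n (ℕ.≤⇒≯ (begin
  n                  ≡⟨ ∣⊤∣≡n n ⟨
  ∣ ⊤ {n} ∣          ≤⟨ p⊆q⇒∣p∣≤∣q∣ {p = ⊤} (λ {p} _ → ⊆-⋃ S _ (proj₂ (cover p))) ⟩
  ∣ ⋃ (tabulate S) ∣ ≤⟨ ∣⋃∣≤k*B S (λ i → ℕ.≮⇒≥ (λ B<∣Si∣ → ¬big (i , B<∣Si∣))) ⟩
  k ℕ.* B            ∎))
  where open ℕ.≤-Reasoning

least : (f : Fin n → ℚ) {S : Subset n} → Nonempty S →
  ∃[ p ] p ∈ S × (∀ {q} → q ∈ S → f p ℚ.≤ f q)
least {n} f {S} (p , p∈S) =
  -- The witness `p` of nonemptiness is the default of `argmin`; since it lies in `S`, the minimizer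
  -- does too.
  argmin f p members ,
  argmin-all f p∈S (All.all-filter (_∈? S) (allFin n)) ,
  λ {q} q∈S → All.lookup (f[argmin]≤f[xs] p members) (∈-filter⁺ (_∈? S) (∈-allFin q) q∈S)
  where
  open Extrema (DecTotalOrder.totalOrder ℚ.≤-decTotalOrder)
    using (argmin; argmin-all; f[argmin]≤f[xs])
  members = filter (_∈? S) (allFin n)

-- Rationals as Dedekind cuts.

fromℚ : ℚ → ℝ
fromℚ c = record
  { L           = ℚ._< c
  ; U           = c ℚ.<_
  ; L-inhabited = c ℚ.- 1ℚ , subst (c ℚ.- 1ℚ ℚ.<_) (ℚ.+-identityʳ c) (ℚ.+-monoʳ-< c (ℚ.negative⁻¹ (ℚ.- 1ℚ)))
  ; U-inhabited = c ℚ.+ 1ℚ , subst (ℚ._< c ℚ.+ 1ℚ) (ℚ.+-identityʳ c) (ℚ.+-monoʳ-< c (ℚ.positive⁻¹ 1ℚ))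
  ; L-rounded   = λ q → mk⇔ ℚ.<-dense (λ (r , q<r , r<c) → ℚ.<-trans q<r r<c)
  ; U-rounded   = λ q → mk⇔ (λ c<q → let r , c<r , r<q = ℚ.<-dense c<q in r , r<q , c<r)
                            (λ (r , r<q , c<r) → ℚ.<-trans c<r r<q)
  ; disjoint    = λ q (q<c , c<q) → ℚ.<-asym q<c c<q
  ; located     = λ q r q<r → located q r q<r (q ℚ.<? c)
  }
  where
  located : ∀ q r → q ℚ.< r → Dec (q ℚ.< c) → q ℚ.< c ⊎ c ℚ.< r
  located q r q<r (yes q<c) = inj₁ q<c
  located q r q<r (no q≮c)  = inj₂ (ℚ.≤-<-trans (ℚ.≮⇒≥ q≮c) q<r)

fromℚ-mono-≤ : ∀ {q r} → q ℚ.≤ r → fromℚ q ≤ fromℚ r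
fromℚ-mono-≤ q≤r s s<q = ℚ.<-≤-trans s<q q≤r

-- If `r < q`, then `r` lies in the lower cut of `q` but not in its own.
fromℚ-cancel-≤ : ∀ {q r} → fromℚ q ≤ fromℚ r → q ℚ.≤ r
fromℚ-cancel-≤ {q} {r} q≤r = ℚ.≮⇒≥ (λ r<q → ℚ.<-irrefl refl (q≤r r r<q))

≤-trans : ∀ {x y z} → x ≤ y → y ≤ z → x ≤ z
≤-trans x≤y y≤z q = y≤z q ∘ x≤y q

-- The imbalance of intervals with a common start and rational ends.

module CommonStart (σ : List Interval) (s : ℚ) (e : Fin (length σ) → ℚ)
  (start≡ : ∀ p → start (lookup σ p) ≡ fromℚ s)
  (end≡   : ∀ p → end (lookup σ p) ≡ fromℚ (e p))
  {k : ℕ} (χ : Coloring k σ)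
  where

  s≤e : ∀ p → s ℚ.≤ e p
  s≤e p = fromℚ-cancel-≤ (subst₂ _≤_ (start≡ p) (end≡ p) (Interval.start≤end (lookup σ p)))

  -- Only the end is tested: this set is used at points `y ≥ s`, which lie to the right of every
  -- start. Rational ends make the test decidable, although `_∈ᴵ_` is not.
  class? : ∀ y i p → Dec (y ℚ.≤ e p × χ p ≡ i)
  class? y i p = (y ℚ.≤? e p) ×-dec (χ p ≟ i)

  class : ℚ → Fin k → Subset (length σ)
  class y i = select (class? y i)

  class-count : ∀ {y} → s ℚ.≤ y → ∀ i → ColorCount σ χ i (fromℚ y) ∣ class y i ∣
  class-count {y} s≤y i = class y i , (λ p → mk⇔ (to p) (from p)) , refl
    where
    to : ∀ p → p ∈ class y i → fromℚ y ∈ᴵ lookup σ p × χ p ≡ i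
    to p p∈ = let y≤ep , χp≡i = ∈-select⁻ (class? y i) p∈ in
      ( subst (_≤ fromℚ y) (sym (start≡ p)) (fromℚ-mono-≤ s≤y)
      , subst (fromℚ y ≤_) (sym (end≡ p)) (fromℚ-mono-≤ y≤ep)) , χp≡i

    from : ∀ p → fromℚ y ∈ᴵ lookup σ p × χ p ≡ i → p ∈ class y i
    from p ((_ , y≤end) , χp≡i) =
      ∈-select⁺ (class? y i) (fromℚ-cancel-≤ (subst (fromℚ y ≤_) (end≡ p) y≤end) , χp≡i)

  class-discrepancy : ∀ {y} → s ℚ.≤ y → ∀ i j →
    Discrepancy σ χ ∣ ∣ class y i ∣ - ∣ class y j ∣ ∣
  class-discrepancy {y} s≤y i j =
    fromℚ y , i , j , _ , _ , class-count s≤y i , class-count s≤y j , refl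

  -- The counts at a real point are those at the leftmost end p of the counted
  -- intervals.
  counted≡class : ∀ {x i S p} → (∀ q → q ∈ S ⇔ (x ∈ᴵ lookup σ q × χ q ≡ i)) →
    x ∈ᴵ lookup σ p → (∀ {q} → q ∈ S → e p ℚ.≤ e q) → S ≡ class (e p) i
  counted≡class {x} {i} {S} {p} S⇔ (start≤x , x≤end) leftmost = ⊆-antisym
    (λ {q} q∈S → ∈-select⁺ (class? (e p) i)
      (leftmost q∈S , proj₂ (Equivalence.to (S⇔ q) q∈S)))
    (λ {q} q∈ → let ep≤eq , χq≡i = ∈-select⁻ (class? (e p) i) q∈ in
      Equivalence.from (S⇔ q)
        ( ( subst (_≤ x) (trans (start≡ p) (sym (start≡ q))) start≤x
          , ≤-trans {x} {fromℚ (e p)} {end (lookup σ q)} (subst (x ≤_) (end≡ p) x≤end)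
              (subst (fromℚ (e p) ≤_) (sym (end≡ q)) (fromℚ-mono-≤ ep≤eq)))
        , χq≡i))

  discrepancyAt : Fin (length σ) × Fin k × Fin k → ℕ
  discrepancyAt (p , i , j) = ∣ ∣ class (e p) i ∣ - ∣ class (e p) j ∣ ∣

  triples : List (Fin (length σ) × Fin k × Fin k)
  triples = cartesianProduct (allFin _) (cartesianProduct (allFin k) (allFin k))

  imbalance : ℕ
  imbalance = max 0 (map discrepancyAt triples)

  discrepancyAt≤imbalance : ∀ t → discrepancyAt t ≤ℕ imbalance
  discrepancyAt≤imbalance (p , i , j) = All.lookup (xs≤max 0 (map discrepancyAt triples))
    (∈-map⁺ discrepancyAt
      (∈-cartesianProduct⁺ (∈-allFin p) (∈-cartesianProduct⁺ (∈-allFin i) (∈-allFin j))))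

  -- The subsets `S` and `T` come with the two counts, so nothing about the real point `x` has to be
  -- decided. If both are empty, then `d` is 0. Otherwise `x` can be moved right to the leftmost end
  -- over the union `S ∪ T` without changing either count, and there `d` is one of the finitely many
  -- values in the maximum.
  discrepancy≤imbalance : ∀ d → Discrepancy σ χ d → d ≤ℕ imbalance
  discrepancy≤imbalance d (x , i , j , _ , _ , (S , S⇔ , refl) , (T , T⇔ , refl) , refl)
    with nonempty? (S ∪ T)
  ... | no empty = ℕ.≤-trans (ℕ.≤-reflexive (cong₂ ∣_-_∣
          (Empty⇒∣p∣≡0 (λ (p , p∈S) → empty (p , p⊆p∪q T p∈S)))
          (Empty⇒∣p∣≡0 (λ (p , p∈T) → empty (p , q⊆p∪q S T p∈T))))) ℕ.z≤n
  ... | yes nonempty =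
    let p , p∈S∪T , leftmost = least e nonempty
        x∈p = [ proj₁ ∘ Equivalence.to (S⇔ p) , proj₁ ∘ Equivalence.to (T⇔ p) ]′ (x∈p∪q⁻ S T p∈S∪T)
        S≡ = counted≡class {x} S⇔ x∈p (leftmost ∘ p⊆p∪q T)
        T≡ = counted≡class {x} T⇔ x∈p (leftmost ∘ q⊆p∪q S T)
    in ℕ.≤-trans (ℕ.≤-reflexive (cong₂ (λ S T → ∣ ∣ S ∣ - ∣ T ∣ ∣) S≡ T≡))
         (discrepancyAt≤imbalance (p , i , j))

  isImbalance : Fin k → IsImbalance σ χ imbalance
  isImbalance i =
    argmax-all id {P = Discrepancy σ χ}
      -- The default 0 of the maximum must be attained as well, even for an empty list: compare
      -- color `i` with itself at the point `s`.
      (subst (Discrepancy σ χ) (ℕ.∣n-n∣≡0 ∣ class s i ∣) (class-discrepancy ℚ.≤-refl i i))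
      (All.map⁺ (All.universal (λ (p , i , j) → class-discrepancy (s≤e p) i j) triples)) ,
    discrepancy≤imbalance

  arrivalOrder : ArrivalOrder σ
  arrivalOrder = subst ArrivalOrder (tabulate-lookup σ)
    (AllPairs.tabulate⁺ (λ {p} {q} _ →
      subst₂ _≤_ (sym (start≡ p)) (sym (start≡ q)) (fromℚ-mono-≤ ℚ.≤-refl)))

-- The bisection game of the adversary.

module _ (s : ℚ) {Red : List Interval → Interval → Set} (Red? : ∀ h I → Dec (Red h I)) where

  -- The prefix `h` holds the rounds already played, so that a game can be built by recursion on the
  -- remaining rounds while `Red` still sees the whole past.
  RedAt : List Interval → (σ : List Interval) → Fin (length σ) → Set
  RedAt h σ p = Red (h ++ take (toℕ p) σ) (lookup σ p)

  record Game (h : List Interval) (lo hi : ℚ) (n : ℕ) : Set₁ where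
    field
      σ         : List Interval
      length≡   : length σ ≡ n
      e         : Fin (length σ) → ℚ
      start≡    : ∀ p → start (lookup σ p) ≡ fromℚ s
      end≡      : ∀ p → end (lookup σ p) ≡ fromℚ (e p)
      lo<e      : ∀ p → lo ℚ.< e p
      e<hi      : ∀ p → e p ℚ.< hi
      separated : ∀ p q → RedAt h σ p → ¬ RedAt h σ q → e q ℚ.< e p

  -- The next interval ends at a point `mid` inside the window. If it is red, all later ends are
  -- kept in `(lo, mid)`, otherwise in `(mid, hi)`; either way red ends stay to the right of the
  -- others.
  play : ∀ h {lo hi} → s ℚ.≤ lo → lo ℚ.< hi → ∀ n → Game h lo hi n
  play h s≤lo lo<hi ℕ.zero = record
    { σ = [] ; length≡ = refl ; e = λ () ; start≡ = λ () ; end≡ = λ ()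
    ; lo<e = λ () ; e<hi = λ () ; separated = λ () }
  play h {lo} {hi} s≤lo lo<hi (suc n) = extend (Red? h I)
    where
    mid    = proj₁ (ℚ.<-dense lo<hi)
    lo<mid = proj₁ (proj₂ (ℚ.<-dense lo<hi))
    mid<hi = proj₂ (proj₂ (ℚ.<-dense lo<hi))
    s≤mid  = ℚ.≤-trans s≤lo (ℚ.<⇒≤ lo<mid)

    I : Interval
    I = record { start = fromℚ s ; end = fromℚ mid ; start≤end = fromℚ-mono-≤ s≤mid }

    -- Both answers share this construction. `G` is the rest of the game in the shrunken window; the
    -- last two hypotheses say on which side of `mid` that window lies.
    module _ {lo′ hi′} (lo≤lo′ : lo ℚ.≤ lo′) (hi′≤hi : hi′ ℚ.≤ hi) (G : Game (h ∷ʳ I) lo′ hi′ n)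
      (mid-red   : Red h I → hi′ ℚ.≤ mid) (mid-other : ¬ Red h I → mid ℚ.≤ lo′) where

      open Game G

      history : ∀ p → RedAt h (I ∷ σ) (suc p) ≡ RedAt (h ∷ʳ I) σ p
      history p = cong (λ h → Red h (lookup σ p)) (sym (++-assoc h (I ∷ []) (take (toℕ p) σ)))

      now : RedAt h (I ∷ σ) zero ≡ Red h I
      now = cong (λ h → Red h I) (++-identityʳ h)

      cons : Game h lo hi (suc n)
      cons = record
        { σ         = I ∷ σ
        ; length≡   = cong suc length≡
        ; e         = e′
        ; start≡    = λ { zero → refl ; (suc p) → start≡ p }
        ; end≡      = λ { zero → refl ; (suc p) → end≡ p }
        ; lo<e      = λ { zero → lo<mid ; (suc p) → ℚ.≤-<-trans lo≤lo′ (lo<e p) }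
        ; e<hi      = λ { zero → mid<hi ; (suc p) → ℚ.<-≤-trans (e<hi p) hi′≤hi }
        ; separated = separated′
        }
        where
        e′ : Fin (suc (length σ)) → ℚ
        e′ zero    = mid
        e′ (suc p) = e p

        separated′ : ∀ p q → RedAt h (I ∷ σ) p → ¬ RedAt h (I ∷ σ) q → e′ q ℚ.< e′ p
        separated′ zero    zero    r ¬r = contradiction r ¬r
        -- A red first end bounds the later window from above; in the next case, one that is not red
        -- bounds it from below.
        separated′ zero    (suc q) r ¬r = ℚ.<-≤-trans (e<hi q) (mid-red (subst id now r))
        separated′ (suc p) zero    r ¬r = ℚ.≤-<-trans (mid-other (¬r ∘ subst id (sym now))) (lo<e p)
        separated′ (suc p) (suc q) r ¬r =
          separated p q (subst id (history p) r) (¬r ∘ subst id (sym (history q)))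

    extend : Dec (Red h I) → Game h lo hi (suc n)
    extend (yes red) = cons ℚ.≤-refl (ℚ.<⇒≤ mid<hi) (play (h ∷ʳ I) s≤lo lo<mid n)
      (λ _ → ℚ.≤-refl) (λ ¬red → contradiction red ¬red)
    extend (no ¬red) = cons (ℚ.<⇒≤ lo<mid) ℚ.≤-refl (play (h ∷ʳ I) s≤mid mid<hi n)
      (λ red → contradiction red ¬red) (λ _ → ℚ.≤-refl)

-- The adversary against a given algorithm.

m+m<n⇒m<n∸o : ∀ {m n o} → m ℕ.+ m <ℕ n → o ≤ℕ m → m <ℕ n ℕ.∸ o
m+m<n⇒m<n∸o {m} m+m<n o≤m = ℕ.m+n≤o⇒m≤o∸n (suc m) (ℕ.≤-trans (ℕ.s≤s (ℕ.+-monoʳ-≤ m o≤m)) m+m<n)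

isZero? : (A : OnlineAlgorithm (suc k)) → ∀ h I → Dec (Func.to A (h , I) ≡ zero)
isZero? A h I = Func.to A (h , I) ≟ zero

-- Red now means color `zero`. The number of colors is `2 + k`, and the number of rounds is one more
-- than `2M` per color, which forces some color to be used more than `2M` times.
game-imbalance : ∀ {M} (A : OnlineAlgorithm (2 ℕ.+ k)) →
  Game 0ℚ (isZero? A) [] 0ℚ 1ℚ (suc ((2 ℕ.+ k) ℕ.* (M ℕ.+ M))) →
  ∃[ σ ] ArrivalOrder σ × (∃[ m ] IsImbalance σ (run A σ) m × M <ℕ m)
game-imbalance {k} {M} A G = σ , arrivalOrder , imbalance , isImbalance zero , M<imbalance
  where
  open Game G
  open CommonStart σ 0ℚ e start≡ end≡ (run A σ)

  exceeds : ∀ {y} → 0ℚ ℚ.≤ y → ∀ i j → M <ℕ ∣ ∣ class y i ∣ - ∣ class y j ∣ ∣ → M <ℕ imbalance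
  exceeds 0≤y i j M<d = ℕ.≤-trans M<d (discrepancy≤imbalance _ (class-discrepancy 0≤y i j))

  M<imbalance : M <ℕ imbalance
  M<imbalance with M ℕ.<? ∣ class 0ℚ zero ∣
  ... | yes M<reds with nonempty? (class 0ℚ zero)
  ...   | no empty = contradiction M<reds (subst (λ r → ¬ M <ℕ r) (sym (Empty⇒∣p∣≡0 empty)) λ ())
  ...   | yes nonempty =
    -- At the leftmost red end every red interval is still counted, while separation puts all ends
    -- of color `suc zero` strictly to its left. This is where a second color is used.
    let p , p∈ , leftmost = least e nonempty
        _ , p-red = ∈-select⁻ (class? 0ℚ zero) p∈
        reds⊆ : class 0ℚ zero ⊆ class (e p) zero
        reds⊆ q∈ = ∈-select⁺ (class? (e p) zero)
          (leftmost q∈ , proj₂ (∈-select⁻ (class? 0ℚ zero) q∈))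
        none : Empty (class (e p) (suc zero))
        none (q , q∈) =
          let ep≤eq , q-one = ∈-select⁻ (class? (e p) (suc zero)) q∈
          in ℚ.<-irrefl refl (ℚ.≤-<-trans ep≤eq
               (separated p q p-red (λ q-red → contradiction (trans (sym q-red) q-one) λ ())))
    in exceeds (s≤e p) zero (suc zero)
         (subst (λ b → M <ℕ ∣ ∣ class (e p) zero ∣ - b ∣) (sym (Empty⇒∣p∣≡0 none))
           (subst (M <ℕ_) (sym (ℕ.∣-∣-identityʳ _)) (ℕ.≤-trans M<reds (p⊆q⇒∣p∣≤∣q∣ reds⊆))))
  M<imbalance | no M≮reds =
    -- The point 0 lies in every interval, so the classes there cover all positions. Color `i`
    -- occurs more than `2M` times and color `zero` at most `M` times.
    let i , 2M<∣i∣ = cover-pigeonhole {B = M ℕ.+ M} (class 0ℚ)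
          (λ p → run A σ p , ∈-select⁺ (class? 0ℚ (run A σ p)) (s≤e p , refl))
          (ℕ.≤-reflexive (sym length≡))
    in exceeds ℚ.≤-refl i zero
         (ℕ.≤-trans (m+m<n⇒m<n∸o 2M<∣i∣ (ℕ.≮⇒≥ M≮reds)) (ℕ.m∸n≤∣m-n∣ ∣ class 0ℚ i ∣ ∣ class 0ℚ zero ∣))

theorem8 : (k : ℕ) → 2 ≤ℕ k → (A : OnlineAlgorithm k) → (M : ℕ) →
    ∃[ σ ] ArrivalOrder σ × (∃[ m ] IsImbalance σ (run A σ) m × M <ℕ m)
theorem8 (suc (suc k)) (ℕ.s≤s (ℕ.s≤s _)) A M =
  game-imbalance A (play 0ℚ (isZero? A) [] ℚ.≤-refl (ℚ.positive⁻¹ 1ℚ) _)
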